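{- There is a $2$-ball-box distribution that does not admit a $6$-term box progression ($6$-BP).
   Context: For an integer $\ell\ge 2$, an $\ell$-ball-box distribution is a surjection $\mathcal{D}:\mathbb{Z}_{>0}\to\mathbb{Z}_{>0}$ (where $\mathcal{D}(i)$ is the label of the box containing ball $i$) such that for every $i\in\mathbb{Z}_{>0}$ the fibre $\mathcal{D}^{ -1}(i)$ is non-empty and has at most $\ell$ elements, and $\mathcal{D}(i)\le\mathcal{D}(i+1)$ for all $i$. Given such $\mathcal{D}$, a $k$-term box progression ($k$-BP) is a sequence of positive integers $h_1,\dots,h_k$ which is a non-trivial $k$-term arithmetic progression (common difference $\neq 0$) and such that $\mathcal{D}(h_1),\dots,\mathcal{D}(h_k)$ is a $k$-term arithmetic progression (possibly trivial, i.e. with common difference $0$). -}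

module Defs where

open import Data.Fin.Base using (Fin; toℕ)
open import Data.Integer.Base as ℤ using (ℤ; +_; 0ℤ)
open import Data.Irrelevant using ([_])
open import Data.List.Base using (List; length)
open import Data.List.Relation.Unary.All using (All)
open import Data.List.Relation.Unary.Unique.Propositional using (Unique)
open import Data.Nat.Base using (ℕ; suc; _≤_; NonZero; NonTrivial)
open import Data.Product.Base using (∃; ∃-syntax; _×_)
open import Data.Refinement.Base using (Refinement; value; _,_)
open import Data.Vec.Functional using (Vector)
open import Function.Base using (_∘_)
open import Function.Definitions using (Surjective)
open import Level using (0ℓ)
open import Relation.Binary.PropositionalEquality.Core using (_≡_; _≢_)
open import Relation.Unary using (Pred)

-- The positivity proof is irrelevant, so two elements with the same value
-- are propositionally equal.
ℕ⁺ : Set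
ℕ⁺ = Refinement ℕ NonZero

suc⁺ : ℕ⁺ → ℕ⁺
suc⁺ n = suc (value n) , [ _ ]

Fibre : (ℕ⁺ → ℕ⁺) → ℕ⁺ → Pred ℕ⁺ 0ℓ
Fibre D i x = D x ≡ i

AtMost : ℕ → Pred ℕ⁺ 0ℓ → Set
AtMost m P = (xs : List ℕ⁺) → Unique xs → All P xs → length xs ≤ m

-- Surjectivity is exactly the requirement that every fibre be non-empty.
-- NonTrivial ℓ says 2 ≤ ℓ.
record IsBallBoxDistribution (ℓ : ℕ) .{{_ : NonTrivial ℓ}} (D : ℕ⁺ → ℕ⁺) : Set where
  field
    surjective : Surjective _≡_ _≡_ D
    fibre-size : ∀ i → AtMost ℓ (Fibre D i)
    monotone   : ∀ i → value (D i) ≤ value (D (suc⁺ i))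

-- Differences are integers, so decreasing progressions are included.
IsAPWithDifference : ∀ {k} → ℤ → Vector ℕ⁺ k → Set
IsAPWithDifference {k} d h =
  ∃[ a ] ((j : Fin k) → + value (h j) ≡ a ℤ.+ + toℕ j ℤ.* d)

IsBoxProgression : (ℕ⁺ → ℕ⁺) → ∀ {k} → Vector ℕ⁺ k → Set
IsBoxProgression D h =
  (∃[ d ] (d ≢ 0ℤ × IsAPWithDifference d h)) × (∃[ e ] IsAPWithDifference e (D ∘ h))

AdmitsBoxProgression : ℕ → (ℕ⁺ → ℕ⁺) → Set
AdmitsBoxProgression k D = ∃ λ (h : Vector ℕ⁺ k) → IsBoxProgression D h

{-# OPTIONS --safe #-}

-- A 2-ball-box distribution is a binary word without factor 00: the letter 1 between two
-- balls means that a new box is started. A 6-term box progression is then an abelian fifth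
-- power, that is, six prefixes whose numbers of zeros and of ones both form progressions.
-- The word is the fixed point of a morphism μ whose matrix M has determinant 81. A cut of
-- μ (μ x) falls into few of the classes of ℤ² / M² ℤ² ≅ ℤ / 6561, and six of these classes
-- are in progression only if they agree modulo 81. This residue determines the part of a
-- cut that lies inside a block μ a up to abelian equivalence, so the six cuts are the
-- images, up to a common translation, of six cuts of μ x in progression; descent ends with
-- a single letter.
module Submission where

open import Defs
open import Data.Bool.Base using (Bool; true; false; T; not; _∧_; _∨_)
open import Data.Bool.ListAction using (all)
open import Data.Bool.Properties using (T?; T-∧; T-∨)
open import Data.Fin.Base using (Fin; zero; suc; inject₁; toℕ)
open import Data.Fin using (#_)
open import Data.Fin.Properties using (toℕ-inject₁)
open import Data.Integer.Base as ℤ using (0ℤ; 1ℤ)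
import Data.Integer.Properties as ℤ
import Data.Integer.Tactic.RingSolver as ℤ-Solver
open import Data.Irrelevant using ([_])
open import Data.List.Base using (List; []; _∷_; _++_; concatMap; filterᵇ; length; map; take; upTo)
open import Data.List.Membership.Propositional using (_∈_)
open import Data.List.Membership.Propositional.Properties
  using (∈-++⁺ˡ; ∈-++⁺ʳ; ∈-map⁺; ∈-filter⁺; ∈-upTo⁺)
open import Data.List.Properties
  using (++-assoc; concatMap-++; length-++; length-take; ∷-injective)
open import Data.List.Relation.Unary.All as All using ([]; _∷_)
open import Data.List.Relation.Unary.All.Properties using (all⁺)
open import Data.List.Relation.Unary.AllPairs using ([]; _∷_)
open import Data.List.Relation.Unary.Any using (here; there)
open import Data.Maybe.Base using (Maybe; just; nothing; is-just)
open import Data.Nat.Base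
open import Data.Nat.Divisibility.Core using (divides-refl)
open import Data.Nat.DivMod
open import Data.Nat.Properties
open import Data.Nat.Tactic.RingSolver using (solve-∀)
open import Data.Product.Base using (∃; ∃-syntax; _×_; _,_; proj₁; proj₂)
open import Data.Refinement.Base using (value; _,_)
open import Data.Refinement.Properties using (value-injective)
open import Data.Sum.Base using (_⊎_; inj₁; inj₂)
open import Data.Unit.Base using (tt)
open import Data.Vec.Functional using (Vector)
open import Function.Base using (_∘_)
open import Function.Bundles using (Equivalence)
open import Function.Definitions using (Surjective)
open import Relation.Binary.Definitions using (tri<; tri≈; tri>)
open import Relation.Binary.PropositionalEquality
open import Relation.Nullary.Negation.Core using (¬_; contradiction)

open ≡-Reasoning

-- Six-term progressions of natural numbers.

-- Subtraction-free form of `c - b = b - a`, so falling progressions are covered as well.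
Balanced : ℕ → ℕ → ℕ → Set
Balanced a b c = a + c ≡ b + b

interchange : ∀ a b c d → (a + b) + (c + d) ≡ (a + c) + (b + d)
interchange = solve-∀

Balanced-+ : ∀ {a b c a′ b′ c′} → Balanced a b c → Balanced a′ b′ c′ →
             Balanced (a + a′) (b + b′) (c + c′)
Balanced-+ {a} {b} {c} {a′} {b′} {c′} e e′ = begin
  (a + a′) + (c + c′) ≡⟨ interchange a a′ c c′ ⟩
  (a + c) + (a′ + c′) ≡⟨ cong₂ _+_ e e′ ⟩
  (b + b) + (b′ + b′) ≡⟨ interchange b b b′ b′ ⟩
  (b + b′) + (b + b′) ∎

Balanced-* : ∀ k {a b c} → Balanced a b c → Balanced (k * a) (k * b) (k * c)
Balanced-* k {a} {b} {c} e = begin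
  k * a + k * c ≡⟨ *-distribˡ-+ k a c ⟨
  k * (a + c)   ≡⟨ cong (k *_) e ⟩
  k * (b + b)   ≡⟨ *-distribˡ-+ k b b ⟩
  k * b + k * b ∎

Balanced-*⁻ : ∀ k .{{_ : NonZero k}} {a b c} → Balanced (k * a) (k * b) (k * c) → Balanced a b c
Balanced-*⁻ k {a} {b} {c} e = *-cancelˡ-≡ (a + c) (b + b) k (begin
  k * (a + c)   ≡⟨ *-distribˡ-+ k a c ⟩
  k * a + k * c ≡⟨ e ⟩
  k * b + k * b ≡⟨ *-distribˡ-+ k b b ⟨
  k * (b + b)   ∎)

Balanced-+⁻ˡ : ∀ {a b c a′ b′ c′} → Balanced (a + a′) (b + b′) (c + c′) → Balanced a b c →
               Balanced a′ b′ c′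
Balanced-+⁻ˡ {a} {b} {c} {a′} {b′} {c′} s e = +-cancelˡ-≡ (a + c) _ _ (begin
  (a + c) + (a′ + c′) ≡⟨ interchange a c a′ c′ ⟩
  (a + a′) + (c + c′) ≡⟨ s ⟩
  (b + b′) + (b + b′) ≡⟨ interchange b b′ b b′ ⟩
  (b + b) + (b′ + b′) ≡⟨ cong (_+ (b′ + b′)) e ⟨
  (a + c) + (b′ + b′) ∎)

record Progression (v : Vector ℕ 6) : Set where
  constructor progression
  field
    balanced : ∀ j → Balanced (v (inject₁ (inject₁ j))) (v (inject₁ (suc j))) (v (suc (suc j)))

open Progression

Progression-cong : ∀ {v w : Vector ℕ 6} → (∀ j → v j ≡ w j) → Progression v → Progression w
Progression-cong e p = progression λ j →
  trans (sym (cong₂ _+_ (e _) (e _))) (trans (balanced p j) (cong₂ _+_ (e _) (e _)))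

Progression-+ : ∀ {v w : Vector ℕ 6} → Progression v → Progression w → Progression (λ j → v j + w j)
Progression-+ {v} {w} p q = progression λ j →
  Balanced-+ {v _} {v _} {v _} {w _} {w _} {w _} (balanced p j) (balanced q j)

Progression-+⁻ˡ : ∀ {v w : Vector ℕ 6} → Progression (λ j → v j + w j) → Progression v → Progression w
Progression-+⁻ˡ {v} {w} s p = progression λ j →
  Balanced-+⁻ˡ {v _} {v _} {v _} {w _} {w _} {w _} (balanced s j) (balanced p j)

Progression-* : ∀ k {v : Vector ℕ 6} → Progression v → Progression (λ j → k * v j)
Progression-* k {v} p = progression λ j → Balanced-* k {v _} {v _} {v _} (balanced p j)

Progression-*⁻ : ∀ k .{{_ : NonZero k}} {v : Vector ℕ 6} → Progression (λ j → k * v j) → Progression v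
Progression-*⁻ k {v} p = progression λ j → Balanced-*⁻ k {v _} {v _} {v _} (balanced p j)

constant-progression : ∀ k → Progression (λ _ → k)
constant-progression k = progression λ _ → refl

-- Letter counts and the morphism `μ`.

zeros ones : List Bool → ℕ
zeros []           = 0
zeros (false ∷ xs) = suc (zeros xs)
zeros (true  ∷ xs) = zeros xs
ones []           = 0
ones (false ∷ xs) = ones xs
ones (true  ∷ xs) = suc (ones xs)

zeros-++ : ∀ xs ys → zeros (xs ++ ys) ≡ zeros xs + zeros ys
zeros-++ []           ys = refl
zeros-++ (false ∷ xs) ys = cong suc (zeros-++ xs ys)
zeros-++ (true  ∷ xs) ys = zeros-++ xs ys

ones-++ : ∀ xs ys → ones (xs ++ ys) ≡ ones xs + ones ys
ones-++ []           ys = refl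
ones-++ (false ∷ xs) ys = ones-++ xs ys
ones-++ (true  ∷ xs) ys = cong suc (ones-++ xs ys)

zeros+ones : ∀ xs → zeros xs + ones xs ≡ length xs
zeros+ones []           = refl
zeros+ones (false ∷ xs) = cong suc (zeros+ones xs)
zeros+ones (true  ∷ xs) = trans (+-suc (zeros xs) (ones xs)) (cong suc (zeros+ones xs))

pattern O = false
pattern I = true

μ : Bool → List Bool
μ O = I ∷ O ∷ I ∷ I ∷ I ∷ I ∷ O ∷ I ∷ O ∷ I ∷ O ∷ I ∷ O ∷ I ∷ I ∷ I ∷ I ∷ O ∷ I ∷ O ∷ I ∷ O ∷ I ∷
      O ∷ I ∷ I ∷ I ∷ I ∷ O ∷ I ∷ O ∷ I ∷ O ∷ []
μ I = I ∷ O ∷ I ∷ I ∷ I ∷ I ∷ O ∷ I ∷ O ∷ I ∷ O ∷ I ∷ O ∷ I ∷ I ∷ I ∷ I ∷ O ∷ I ∷ I ∷ I ∷ I ∷ O ∷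
      I ∷ I ∷ I ∷ []

μ* : List Bool → List Bool
μ* = concatMap μ

zeros-μ* : ∀ xs → zeros (μ* xs) ≡ 12 * zeros xs + 7 * ones xs
zeros-μ* []           = refl
zeros-μ* (false ∷ xs) = trans (zeros-++ (μ false) (μ* xs))
  (trans (cong (12 +_) (zeros-μ* xs)) (lemma 12 7 (zeros xs) (ones xs)))
  where
  lemma : ∀ a b x y → a + (a * x + b * y) ≡ a * suc x + b * y
  lemma = solve-∀
zeros-μ* (true ∷ xs) = trans (zeros-++ (μ true) (μ* xs))
  (trans (cong (7 +_) (zeros-μ* xs)) (lemma 12 7 (zeros xs) (ones xs)))
  where
  lemma : ∀ a b x y → b + (a * x + b * y) ≡ a * x + b * suc y
  lemma = solve-∀

ones-μ* : ∀ xs → ones (μ* xs) ≡ 21 * zeros xs + 19 * ones xs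
ones-μ* []           = refl
ones-μ* (false ∷ xs) = trans (ones-++ (μ false) (μ* xs))
  (trans (cong (21 +_) (ones-μ* xs)) (lemma 21 19 (zeros xs) (ones xs)))
  where
  lemma : ∀ a b x y → a + (a * x + b * y) ≡ a * suc x + b * y
  lemma = solve-∀
ones-μ* (true ∷ xs) = trans (ones-++ (μ true) (μ* xs))
  (trans (cong (19 +_) (ones-μ* xs)) (lemma 21 19 (zeros xs) (ones xs)))
  where
  lemma : ∀ a b x y → b + (a * x + b * y) ≡ a * x + b * suc y
  lemma = solve-∀

parikh : List Bool → ℕ × ℕ
parikh xs = zeros xs , ones xs

-- Cuts of words and desubstitution.

-- The next letter `b` is recorded because `μ b` is the block in which a cut of the image falls.
Cut : List Bool → List Bool → Bool → Set
Cut xs ys b = ∃[ zs ] xs ≡ ys ++ b ∷ zs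

Cut-++ˡ : ∀ {xs ys b} vs → Cut xs ys b → Cut (xs ++ vs) ys b
Cut-++ˡ {ys = ys} {b} vs (zs , refl) = zs ++ vs , ++-assoc ys (b ∷ zs) vs

Cut-∷ : ∀ {x xs ys b} → Cut xs ys b → Cut (x ∷ xs) (x ∷ ys) b
Cut-∷ (zs , eq) = zs , cong (_ ∷_) eq

Cut-++⁻ : ∀ us {vs ys b} → Cut (us ++ vs) ys b →
          Cut us ys b ⊎ ∃[ ys′ ] (ys ≡ us ++ ys′ × Cut vs ys′ b)
Cut-++⁻ []                   c           = inj₂ (_ , refl , c)
Cut-++⁻ (u ∷ us) {ys = []}     (zs , refl) = inj₁ (us , refl)
Cut-++⁻ (u ∷ us) {ys = y ∷ ys} (zs , eq) with ∷-injective eq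
... | refl , eq′ with Cut-++⁻ us (zs , eq′)
...   | inj₁ c               = inj₁ (Cut-∷ c)
...   | inj₂ (ys′ , refl , c) = inj₂ (ys′ , refl , c)

Cut-take : ∀ n xs → n < length xs → ∃[ b ] Cut xs (take n xs) b
Cut-take zero    (x ∷ xs) _        = x , xs , refl
Cut-take (suc n) (x ∷ xs) (s≤s n<) with Cut-take n xs n<
... | b , c = b , Cut-∷ c

cuts : List Bool → List (List Bool × Bool)
cuts []       = []
cuts (x ∷ xs) = ([] , x) ∷ map (λ (ys , b) → x ∷ ys , b) (cuts xs)

Cut⇒∈cuts : ∀ {xs ys b} → Cut xs ys b → (ys , b) ∈ cuts xs
Cut⇒∈cuts {ys = []}     (zs , refl) = here refl
Cut⇒∈cuts {ys = y ∷ ys} (zs , refl) = there (∈-map⁺ _ (Cut⇒∈cuts (zs , refl)))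

-- A cut on a block boundary is charged to the block that starts there, so `r` is always a proper
-- prefix of `μ a`.
Cut-μ* : ∀ xs {ys b} → Cut (μ* xs) ys b →
         ∃[ c ] ∃[ a ] ∃[ r ] (Cut xs c a × ys ≡ μ* c ++ r × Cut (μ a) r b)
Cut-μ* []       {[]}    (_ , ())
Cut-μ* []       {_ ∷ _} (_ , ())
Cut-μ* (x ∷ xs) cut with Cut-++⁻ (μ x) cut
... | inj₁ c = [] , x , _ , (xs , refl) , refl , c
... | inj₂ (ys′ , refl , c′) with Cut-μ* xs c′
...   | c , a , r , cut-c , refl , cut-r =
  x ∷ c , a , r , Cut-∷ cut-c , sym (++-assoc (μ x) (μ* c) r) , cut-r

-- Rigid words and weights of cuts.

-- In a progression, agreement of the first two terms forces agreement of all six, so this excludes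
-- non-empty abelian fifth powers between cuts of `xs`.
Rigid : List Bool → Set
Rigid xs = (ys : Fin 6 → List Bool) → (∀ j → ∃ (Cut xs (ys j))) →
           Progression (zeros ∘ ys) → Progression (ones ∘ ys) →
           parikh (ys zero) ≡ parikh (ys (suc zero))

-- The matrix M = (12 7 ; 21 19) of μ has determinant 81.  The coefficient is
-- chosen so that weight is divisible by 81 on the image of M and by 81 ^ 2 on
-- the image of M ^ 2; it induces isomorphisms ℤ² / M ℤ² ≅ ℤ / 81 and
-- ℤ² / M² ℤ² ≅ ℤ / 6561.
weight : List Bool → ℕ
weight xs = 1328 * zeros xs + ones xs

weight-++ : ∀ xs ys → weight (xs ++ ys) ≡ weight xs + weight ys
weight-++ xs ys = begin
  1328 * zeros (xs ++ ys) + ones (xs ++ ys)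
    ≡⟨ cong₂ (λ x y → 1328 * x + y) (zeros-++ xs ys) (ones-++ xs ys) ⟩
  1328 * (zeros xs + zeros ys) + (ones xs + ones ys)
    ≡⟨ lemma 1328 (zeros xs) (zeros ys) (ones xs) (ones ys) ⟩
  weight xs + weight ys ∎
  where
  lemma : ∀ k a b c d → k * (a + b) + (c + d) ≡ (k * a + c) + (k * b + d)
  lemma = solve-∀

weight-μ* : ∀ xs → weight (μ* xs) ≡ (197 * zeros xs + 115 * ones xs) * 81
weight-μ* xs = begin
  1328 * zeros (μ* xs) + ones (μ* xs)
    ≡⟨ cong₂ (λ x y → 1328 * x + y) (zeros-μ* xs) (ones-μ* xs) ⟩
  1328 * (12 * zeros xs + 7 * ones xs) + (21 * zeros xs + 19 * ones xs)
    ≡⟨ lemma₁ 1328 12 7 21 19 (zeros xs) (ones xs) ⟩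
  (1328 * 12 + 21) * zeros xs + (1328 * 7 + 19) * ones xs
    -- `1328 * 12 + 21 = 197 * 81` and `1328 * 7 + 19 = 115 * 81`.
    ≡⟨ lemma₂ 197 115 81 (zeros xs) (ones xs) ⟩
  (197 * zeros xs + 115 * ones xs) * 81 ∎
  where
  lemma₁ : ∀ k a b c d x y → k * (a * x + b * y) + (c * x + d * y) ≡ (k * a + c) * x + (k * b + d) * y
  lemma₁ = solve-∀
  lemma₂ : ∀ a b n x y → (a * n) * x + (b * n) * y ≡ (a * x + b * y) * n
  lemma₂ = solve-∀

weight-μ*μ* : ∀ xs → weight (μ* (μ* xs)) ≡ (59 * zeros xs + 44 * ones xs) * 6561
weight-μ*μ* xs = begin
  weight (μ* (μ* xs))
    ≡⟨ weight-μ* (μ* xs) ⟩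
  (197 * zeros (μ* xs) + 115 * ones (μ* xs)) * 81
    ≡⟨ cong₂ (λ x y → (197 * x + 115 * y) * 81) (zeros-μ* xs) (ones-μ* xs) ⟩
  (197 * (12 * zeros xs + 7 * ones xs) + 115 * (21 * zeros xs + 19 * ones xs)) * 81
    ≡⟨ lemma₁ 197 115 12 7 21 19 81 (zeros xs) (ones xs) ⟩
  ((197 * 12 + 115 * 21) * 81) * zeros xs + ((197 * 7 + 115 * 19) * 81) * ones xs
    -- `197 * 12 + 115 * 21 = 59 * 81` and `197 * 7 + 115 * 19 = 44 * 81`.
    ≡⟨ lemma₂ 59 44 6561 (zeros xs) (ones xs) ⟩
  (59 * zeros xs + 44 * ones xs) * 6561 ∎
  where
  lemma₁ : ∀ e f a b c d n x y → (e * (a * x + b * y) + f * (c * x + d * y)) * n ≡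
           ((e * a + f * c) * n) * x + ((e * b + f * d) * n) * y
  lemma₁ = solve-∀
  lemma₂ : ∀ a b n x y → (a * n) * x + (b * n) * y ≡ (a * x + b * y) * n
  lemma₂ = solve-∀

-- Progressions modulo `n`.

-- Here n ∸ a stands for - a modulo n; the arguments are reduced, so nothing is truncated.
next : ∀ n .{{_ : NonZero n}} → ℕ → ℕ → ℕ
next n a b = ((b + b) + (n ∸ a)) % n

Balanced⇒next : ∀ n .{{_ : NonZero n}} {a b c} → Balanced a b c → c % n ≡ next n (a % n) (b % n)
Balanced⇒next n {a} {b} {c} e = sym (begin
  ((b % n + b % n) + t) % n             ≡⟨ %-distribˡ-+ (b % n + b % n) t n ⟩
  ((b % n + b % n) % n + t % n) % n     ≡⟨ cong (λ z → (z + t % n) % n) (%-distribˡ-+ b b n) ⟨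
  ((b + b) % n + t % n) % n             ≡⟨ cong (λ z → (z % n + t % n) % n) e ⟨
  ((a + c) % n + t % n) % n             ≡⟨ cong (λ z → (z + t % n) % n) (%-distribˡ-+ a c n) ⟩
  ((a % n + c % n) % n + t % n) % n     ≡⟨ %-distribˡ-+ (a % n + c % n) t n ⟨
  ((a % n + c % n) + t) % n             ≡⟨ cong (_% n) (swap (a % n) (c % n) t) ⟩
  (c % n + (a % n + t)) % n             ≡⟨ cong (λ z → (c % n + z) % n) (m+[n∸m]≡n (m%n≤n a n)) ⟩
  (c % n + n) % n                       ≡⟨ [m+n]%n≡m%n (c % n) n ⟩
  c % n % n                             ≡⟨ m%n%n≡m%n c n ⟩
  c % n                                 ∎)
  where
  t = n ∸ a % n
  swap : ∀ x y z → (x + y) + z ≡ y + (x + z)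
  swap = solve-∀

-- Both sides are `next` of the same residues, since `b` is also the third term of the constant
-- progression `b, b, b`.
Balanced-%-const : ∀ n .{{_ : NonZero n}} {a b c} → Balanced a b c → a % n ≡ b % n → b % n ≡ c % n
Balanced-%-const n {a} {b} {c} e a≡b = begin
  b % n                  ≡⟨ Balanced⇒next n {b} {b} {b} refl ⟩
  next n (b % n) (b % n) ≡⟨ cong (λ z → next n z (b % n)) a≡b ⟨
  next n (a % n) (b % n) ≡⟨ Balanced⇒next n {a} {b} {c} e ⟨
  c % n                  ∎

module _ (n : ℕ) .{{_ : NonZero n}} (p : ℕ → Bool) where

  -- The auxiliary function makes the evaluator share the computed third term.
  extends : ℕ → ℕ → ℕ → Bool
  extendsBy : ℕ → ℕ → ℕ → Bool
  extends zero    a b = true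
  extends (suc k) a b = extendsBy k b (next n a b)
  extendsBy k b c = p c ∧ extends k b c

  Progression⇒extends : ∀ {v} → Progression v → (∀ j → T (p (v j % n))) →
                        T (extends 4 (v zero % n) (v (suc zero) % n))
  Progression⇒extends {v} bal pv =
    -- The test unfolds from the first pair, so its proof is assembled from the last triple
    -- backwards.
    step 3 (# 0) (step 2 (# 1) (step 1 (# 2) (step 0 (# 3) _)))
    where
    step : ∀ k j → T (extends k (v (inject₁ (suc j)) % n) (v (suc (suc j)) % n)) →
           T (extends (suc k) (v (inject₁ (inject₁ j)) % n) (v (inject₁ (suc j)) % n))
    step k j ext = subst (λ c → T (p c ∧ extends k (v (inject₁ (suc j)) % n) c))
      (Balanced⇒next n {v (inject₁ (inject₁ j))} (balanced bal j))
      (Equivalence.from T-∧ (pv (suc (suc j)) , ext))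

-- Tables of the residues of cuts modulo 6561.

-- height b lists, in base 9, the h < 81 such that a prefix r of a block μ a which is followed
-- by the letter b satisfies weight (μ* r) ≡ 81 h modulo 6561.
height : Bool → ℕ → ℕ → Bool
height O 0 4 = true
height O 0 7 = true
height O 1 7 = true
height O 2 1 = true
height O 2 7 = true
height O 3 4 = true
height O 3 7 = true
height O 4 7 = true
height O 5 1 = true
height O 6 4 = true
height O 6 7 = true
height O 7 7 = true
height O 8 1 = true
height I 0 0 = true
height I 0 2 = true
height I 0 4 = true
height I 1 0 = true
height I 1 3 = true
height I 1 4 = true
height I 1 6 = true
height I 2 4 = true
height I 2 6 = true
height I 3 0 = true
height I 3 2 = true
height I 4 0 = true
height I 4 2 = true
height I 4 3 = true
height I 4 6 = true
height I 5 2 = true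
height I 5 4 = true
height I 5 6 = true
height I 6 0 = true
height I 6 2 = true
height I 6 6 = true
height I 7 0 = true
height I 7 3 = true
height I 7 6 = true
height I 8 0 = true
height I 8 4 = true
height I 8 6 = true
height _ _ _ = false

anyHeight : ℕ → ℕ → Bool
anyHeight i j = height O i j ∨ height I i j

-- All the proper prefixes of μ O and μ I with the same weight modulo 81, given in base 9, have
-- the same weight modulo 6561.  The predicate selects the heights of the letters whose blocks
-- have such a prefix, hence the possible weights 81 h + w of cuts of μ* (μ* x).
site : ℕ → ℕ → Maybe (ℕ × (ℕ → ℕ → Bool))
site 0 0 = just (0 , anyHeight)
site 0 1 = just (1 , anyHeight)
site 0 6 = just (87 , anyHeight)
site 0 7 = just (88 , anyHeight)
site 0 8 = just (89 , anyHeight)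
site 1 0 = just (90 , anyHeight)
site 1 1 = just (91 , anyHeight)
site 1 6 = just (177 , height O)
site 1 7 = just (178 , height O)
site 2 3 = just (3990 , anyHeight)
site 2 4 = just (3991 , anyHeight)
site 3 0 = just (4077 , height O)
site 3 1 = just (4078 , height O)
site 3 6 = just (1329 , anyHeight)
site 3 7 = just (1330 , anyHeight)
site 3 8 = just (1331 , anyHeight)
site 4 0 = just (1332 , anyHeight)
site 4 1 = just (1333 , anyHeight)
site 4 6 = just (1419 , anyHeight)
site 4 7 = just (1420 , anyHeight)
site 4 8 = just (1421 , height I)
site 5 0 = just (1422 , height I)
site 5 1 = just (1423 , height I)
site 5 3 = just (1506 , height O)
site 5 4 = just (1507 , height O)
site 6 0 = just (5319 , anyHeight)
site 6 1 = just (5320 , anyHeight)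
site 6 6 = just (5406 , height O)
site 6 7 = just (5407 , height O)
site 6 8 = just (5408 , height O)
site 7 0 = just (5409 , height O)
site 7 1 = just (5410 , height O)
site 7 6 = just (2661 , anyHeight)
site 7 7 = just (2662 , anyHeight)
site 8 3 = just (2748 , height O)
site 8 4 = just (2749 , height O)
site 8 6 = just (2751 , height I)
site 8 7 = just (2752 , height I)
site 8 8 = just (2753 , height I)
site _ _ = nothing

low : ℕ → Bool
low r = is-just (site (r / 9) (r % 9))

holdsAt : (ℕ → ℕ → Bool) → ℕ → Bool
holdsAt p h = p (h / 9) (h % 9)

fits : ℕ → Maybe (ℕ × (ℕ → ℕ → Bool)) → Bool
fits x nothing        = false
-- Solves `x ≡ 81 h + w` modulo 6561 for `h`. Adding 6561 avoids truncation, and the final `% 81`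
-- removes it again.
fits x (just (w , p)) = holdsAt p ((x + (6561 ∸ w)) / 81 % 81)

high : ℕ → Bool
high x = fits x (site (x % 81 / 9) (x % 81 % 9))

fits⇒is-just : ∀ x s → T (fits x s) → T (is-just s)
fits⇒is-just x (just _) _ = tt

high⇒low : ∀ x → T (high x) → T (low (x % 81))
high⇒low x = fits⇒is-just x (site (x % 81 / 9) (x % 81 % 9))

-- Finite checks by evaluation.

-- Here `k * 81` is the weight of `μ* r`, where `r` is a partial block one level up and `b` is the
-- letter after it.
coversFrom : ℕ → Bool → Bool
coversFrom k b = all (λ (s , _) → high ((weight s + k * 81) % 6561)) (cuts (μ b))

covers : Bool → Bool
covers a = all (λ (r , b) → coversFrom (197 * zeros r + 115 * ones r) b) (cuts (μ a))

-- Evaluation over all nested cuts shows that `height` and `site` omit none of them.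
covered : ∀ a → T (covers a)
covered O = tt
covered I = tt

lifts : ℕ → List ℕ
lifts r = filterᵇ high (map (λ t → r + t * 81) (upTo 81))

noHighProgression : List ℕ → List ℕ → Bool
noHighProgression xs xs′ = all (λ x → all (λ x′ → not (extends 6561 high 4 x x′)) xs′) xs

-- Distinct residues are to be refuted modulo 81 or, after lifting, modulo 6561. `extends` tests
-- only the four later terms, but a residue outside `low` has no `lifts`, so such a pair passes
-- vacuously.
collapses : ℕ → ℕ → Bool
collapses r r′ = (r ≡ᵇ r′) ∨ not (extends 81 low 4 r r′) ∨ noHighProgression (lifts r) (lifts r′)

-- The computational core: the first two residues determine the other four, so a search over pairs
-- is exhaustive.
all-collapse : T (all (λ r → all (collapses r) (upTo 81)) (upTo 81))
all-collapse = tt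

agrees : List Bool → List Bool → Bool
agrees r r′ = not (weight r % 81 ≡ᵇ weight r′ % 81) ∨ (zeros r ≡ᵇ zeros r′) ∧ (ones r ≡ᵇ ones r′)

letterCuts : List (List Bool × Bool)
letterCuts = cuts (μ O) ++ cuts (μ I)

-- This lets the partial blocks cancel in the descent, even when they come from different letters.
all-agree : T (all (λ (r , _) → all (λ (r′ , _) → agrees r r′) letterCuts) letterCuts)
all-agree = tt

-- From the finite checks to arbitrary cuts and progressions.

all-lookup : ∀ {A : Set} (p : A → Bool) {xs x} → T (all p xs) → x ∈ xs → T (p x)
all-lookup p t = All.lookup (all⁺ p _ t)

T-not : ∀ {b} → T b → ¬ T (not b)
T-not {true} _ ()

Progression⇒collapse : ∀ {v} → Progression v → (∀ j → T (high (v j % 6561))) →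
                       v zero % 81 ≡ v (suc zero) % 81
Progression⇒collapse {v} bal hi = decide (all-lookup (collapses (r zero))
  (all-lookup (λ s → all (collapses s) (upTo 81)) all-collapse (r∈ zero)) (r∈ (suc zero)))
  where
  r x : Fin 6 → ℕ
  r j = v j % 81
  x j = v j % 6561

  r∈ : ∀ j → r j ∈ upTo 81
  r∈ j = ∈-upTo⁺ (m%n<n (v j) 81)

  x%81 : ∀ j → x j % 81 ≡ r j
  x%81 j = m∣n⇒o%n%m≡o%m 81 6561 (v j) (divides-refl 81)

  lo : ∀ j → T (low (r j))
  lo j = subst (T ∘ low) (x%81 j) (high⇒low (x j) (hi j))

  lift∈ : ∀ j → x j ∈ lifts (r j)
  lift∈ j = ∈-filter⁺ (T? ∘ high) (subst (_∈ map (λ t → r j + t * 81) (upTo 81)) (sym x≡)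
    (∈-map⁺ (λ t → r j + t * 81) (∈-upTo⁺ (m<n*o⇒m/o<n {x j} {81} {81} (m%n<n (v j) 6561))))) (hi j)
    where
    x≡ : x j ≡ r j + x j / 81 * 81
    x≡ = trans (m≡m%n+[m/n]*n (x j) 81) (cong (_+ x j / 81 * 81) (x%81 j))

  decide : T (collapses (r zero) (r (suc zero))) → r zero ≡ r (suc zero)
  decide t with Equivalence.to T-∨ t
  ... | inj₁ r≡ = ≡ᵇ⇒≡ (r zero) (r (suc zero)) r≡
  -- The residues of `v` survive both tests, which rules out the two refuting alternatives.
  ... | inj₂ t′ with Equivalence.to T-∨ t′
  ...   | inj₁ ¬low = contradiction ¬low (T-not (Progression⇒extends 81 low bal lo))
  ...   | inj₂ ¬high = contradiction
    (all-lookup (λ y → not (extends 6561 high 4 (x zero) y))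
      (all-lookup (λ y → all (λ y′ → not (extends 6561 high 4 y y′)) (lifts (r (suc zero))))
        ¬high (lift∈ zero)) (lift∈ (suc zero)))
    (T-not (Progression⇒extends 6561 high bal hi))

-- Desubstituting twice gives `ys ≡ μ* (μ* c ++ r) ++ s`. The weight of `μ* (μ* c)` vanishes modulo
-- 6561, so only the partial blocks `r` and `s` matter, and `covered` has checked these.
Cut⇒high : ∀ xs {ys b} → Cut (μ* (μ* xs)) ys b → T (high (weight ys % 6561))
Cut⇒high xs cut with Cut-μ* (μ* xs) cut
... | _ , b , s , cut-c , refl , cut-s with Cut-μ* xs cut-c
...   | c , a , r , _ , refl , cut-r = subst (T ∘ high) (sym residue)
  (all-lookup _ (all-lookup (λ (r , b) → coversFrom (197 * zeros r + 115 * ones r) b)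
    (covered a) (Cut⇒∈cuts cut-r)) (Cut⇒∈cuts cut-s))
  where
  k l : ℕ
  k = 197 * zeros r + 115 * ones r
  l = 59 * zeros c + 44 * ones c
  residue : weight (μ* (μ* c ++ r) ++ s) % 6561 ≡ (weight s + k * 81) % 6561
  residue = begin
    weight (μ* (μ* c ++ r) ++ s) % 6561
      ≡⟨ cong (_% 6561) (weight-++ (μ* (μ* c ++ r)) s) ⟩
    (weight (μ* (μ* c ++ r)) + weight s) % 6561
      ≡⟨ cong (λ zs → (weight zs + weight s) % 6561) (concatMap-++ μ (μ* c) r) ⟩
    (weight (μ* (μ* c) ++ μ* r) + weight s) % 6561
      ≡⟨ cong (λ w → (w + weight s) % 6561) (weight-++ (μ* (μ* c)) (μ* r)) ⟩
    (weight (μ* (μ* c)) + weight (μ* r) + weight s) % 6561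
      ≡⟨ cong₂ (λ w w′ → (w + w′ + weight s) % 6561) (weight-μ*μ* c) (weight-μ* r) ⟩
    (l * 6561 + k * 81 + weight s) % 6561
      ≡⟨ cong (_% 6561) (rotate (l * 6561) (k * 81) (weight s)) ⟩
    (weight s + k * 81 + l * 6561) % 6561
      ≡⟨ [m+kn]%n≡m%n (weight s + k * 81) l 6561 ⟩
    (weight s + k * 81) % 6561 ∎
    where
    rotate : ∀ x y z → x + y + z ≡ z + y + x
    rotate = solve-∀

∈letterCuts : ∀ a {r b} → Cut (μ a) r b → (r , b) ∈ letterCuts
∈letterCuts O cut = ∈-++⁺ˡ (Cut⇒∈cuts cut)
∈letterCuts I cut = ∈-++⁺ʳ (cuts (μ O)) (Cut⇒∈cuts cut)

parikh-unique : ∀ a a′ {r b r′ b′} → Cut (μ a) r b → Cut (μ a′) r′ b′ →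
                weight r % 81 ≡ weight r′ % 81 → zeros r ≡ zeros r′ × ones r ≡ ones r′
parikh-unique a a′ {r} {b} {r′} {b′} cut cut′ e
  with Equivalence.to T-∨ (all-lookup (λ (s , _) → agrees r s)
    (all-lookup (λ (s , _) → all (λ (s′ , _) → agrees s s′) letterCuts) all-agree (∈letterCuts a cut))
    (∈letterCuts a′ cut′))
... | inj₁ w≢ = contradiction w≢ (T-not (≡⇒≡ᵇ (weight r % 81) (weight r′ % 81) e))
... | inj₂ t with Equivalence.to T-∧ t
...   | z , o = ≡ᵇ⇒≡ (zeros r) _ z , ≡ᵇ⇒≡ (ones r) _ o

%-constant : ∀ n .{{_ : NonZero n}} {v} → Progression v → v zero % n ≡ v (suc zero) % n →
             ∀ j → v j % n ≡ v zero % n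
%-constant n {v} bal e₁ = constant
  where
  shift : ∀ j → v (inject₁ (inject₁ j)) % n ≡ v (inject₁ (suc j)) % n →
          v (inject₁ (suc j)) % n ≡ v (suc (suc j)) % n
  shift j = Balanced-%-const n {v (inject₁ (inject₁ j))} {v (inject₁ (suc j))} {v (suc (suc j))} (balanced bal j)
  e₂ = shift (# 0) e₁
  e₃ = shift (# 1) e₂
  e₄ = shift (# 2) e₃
  e₅ = shift (# 3) e₄
  constant : ∀ j → v j % n ≡ v zero % n
  constant zero                               = refl
  constant (suc zero)                         = sym e₁
  constant (suc (suc zero))                   = sym (trans e₁ e₂)
  constant (suc (suc (suc zero)))             = sym (trans e₁ (trans e₂ e₃))
  constant (suc (suc (suc (suc zero))))       = sym (trans e₁ (trans e₂ (trans e₃ e₄)))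
  constant (suc (suc (suc (suc (suc zero))))) = sym (trans e₁ (trans e₂ (trans e₃ (trans e₄ e₅))))

weight-%-μ* : ∀ c r → weight (μ* c ++ r) % 81 ≡ weight r % 81
weight-%-μ* c r = begin
  weight (μ* c ++ r) % 81      ≡⟨ cong (_% 81) (weight-++ (μ* c) r) ⟩
  (weight (μ* c) + weight r) % 81
    ≡⟨ cong (λ w → (w + weight r) % 81) (weight-μ* c) ⟩
  ((197 * zeros c + 115 * ones c) * 81 + weight r) % 81
    ≡⟨ cong (_% 81) (+-comm ((197 * zeros c + 115 * ones c) * 81) (weight r)) ⟩
  (weight r + (197 * zeros c + 115 * ones c) * 81) % 81
    ≡⟨ [m+kn]%n≡m%n (weight r) (197 * zeros c + 115 * ones c) 81 ⟩
  weight r % 81 ∎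

-- Descent through `μ`.

-- Solves for `z` without subtraction: `v` is cancelled from `w`, then the factor 81.
resolve : ∀ {v w z : Vector ℕ 6} → (∀ j → v j + 81 * z j ≡ w j) → Progression v → Progression w →
          Progression z
resolve e p q = Progression-*⁻ 81 (Progression-+⁻ˡ (Progression-cong (sym ∘ e) q) p)

-- Multiplication by the adjugate of the matrix of μ inverts it up to the factor 81.
Progression-μ⁻ : ∀ {x y : Vector ℕ 6} →
                 Progression (λ j → 12 * x j + 7 * y j) → Progression (λ j → 21 * x j + 19 * y j) →
                 Progression x × Progression y
Progression-μ⁻ {x} {y} p q =
  resolve (λ j → eqˣ (x j) (y j)) (Progression-* 7 q) (Progression-* 19 p) ,
  resolve (λ j → eqʸ (x j) (y j)) (Progression-* 21 p) (Progression-* 12 q)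
  where
  -- The adjugate is `(19 -7 ; -21 12)`; its negative entries are moved to the left-hand sides.
  eqˣ : ∀ x y → 7 * (21 * x + 19 * y) + 81 * x ≡ 19 * (12 * x + 7 * y)
  eqˣ = solve-∀
  eqʸ : ∀ x y → 21 * (12 * x + 7 * y) + 81 * y ≡ 12 * (21 * x + 19 * y)
  eqʸ = solve-∀

-- The classes modulo 6561 are known only for cuts of a double image. `μ* zs` need not be one, but
-- being a prefix of one suffices.
Rigid-μ* : ∀ {zs vs} xs → μ* zs ++ vs ≡ μ* (μ* xs) → Rigid zs → Rigid (μ* zs)
Rigid-μ* {zs} {vs} xs eq rigid ys cut bz bo = cong₂ _,_
  (trans (zeros-ys zero) (trans (cong (λ (x , y) → 12 * x + 7 * y + zeros (r zero)) same-c)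
    (sym (zeros-ys (suc zero)))))
  (trans (ones-ys zero) (trans (cong (λ (x , y) → 21 * x + 19 * y + ones (r zero)) same-c)
    (sym (ones-ys (suc zero)))))
  where
  pieces : ∀ j → ∃[ c ] ∃[ a ] ∃[ r ] (Cut zs c a × ys j ≡ μ* c ++ r × Cut (μ a) r (proj₁ (cut j)))
  pieces j = Cut-μ* zs (proj₂ (cut j))

  c r : Fin 6 → List Bool
  c j = proj₁ (pieces j)
  r j = proj₁ (proj₂ (proj₂ (pieces j)))

  a : Fin 6 → Bool
  a j = proj₁ (proj₂ (pieces j))

  cut-c : ∀ j → Cut zs (c j) (a j)
  cut-c j = proj₁ (proj₂ (proj₂ (proj₂ (pieces j))))

  ys≡ : ∀ j → ys j ≡ μ* (c j) ++ r j
  ys≡ j = proj₁ (proj₂ (proj₂ (proj₂ (proj₂ (pieces j)))))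

  cut-r : ∀ j → Cut (μ (a j)) (r j) (proj₁ (cut j))
  cut-r j = proj₂ (proj₂ (proj₂ (proj₂ (proj₂ (pieces j)))))

  weights : Progression (weight ∘ ys)
  weights = Progression-+ (Progression-* 1328 bz) bo

  residue : ∀ j → weight (ys j) % 81 ≡ weight (r j) % 81
  residue j = trans (cong (λ zs → weight zs % 81) (ys≡ j)) (weight-%-μ* (c j) (r j))

  high-ys : ∀ j → T (high (weight (ys j) % 6561))
  high-ys j = Cut⇒high xs (subst (λ ws → Cut ws (ys j) (proj₁ (cut j))) eq (Cut-++ˡ vs (proj₂ (cut j))))

  -- By the collapse modulo 81, all six partial blocks have the same letter counts and can be
  -- removed as a common translation.
  same-r : ∀ j → zeros (r j) ≡ zeros (r zero) × ones (r j) ≡ ones (r zero)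
  same-r j = parikh-unique (a j) (a zero) (cut-r j) (cut-r zero)
    (trans (sym (residue j)) (trans
      (%-constant 81 weights (Progression⇒collapse weights high-ys) j)
      (residue zero)))

  zeros-ys : ∀ j → zeros (ys j) ≡ 12 * zeros (c j) + 7 * ones (c j) + zeros (r zero)
  zeros-ys j = trans (cong zeros (ys≡ j)) (trans (zeros-++ (μ* (c j)) (r j))
    (cong₂ _+_ (zeros-μ* (c j)) (proj₁ (same-r j))))

  ones-ys : ∀ j → ones (ys j) ≡ 21 * zeros (c j) + 19 * ones (c j) + ones (r zero)
  ones-ys j = trans (cong ones (ys≡ j)) (trans (ones-++ (μ* (c j)) (r j))
    (cong₂ _+_ (ones-μ* (c j)) (proj₂ (same-r j))))

  untranslate : ∀ {v w : Vector ℕ 6} k → (∀ j → w j ≡ v j + k) → Progression w → Progression v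
  untranslate k e p = Progression-+⁻ˡ (Progression-cong (λ j → trans (e j) (+-comm _ k)) p)
                                      (constant-progression k)

  progressions : Progression (zeros ∘ c) × Progression (ones ∘ c)
  progressions = Progression-μ⁻ (untranslate (zeros (r zero)) zeros-ys bz)
                                (untranslate (ones (r zero)) ones-ys bo)

  same-c : parikh (c zero) ≡ parikh (c (suc zero))
  same-c = rigid c (λ j → a j , cut-c j) (proj₁ progressions) (proj₂ progressions)

-- The fixed point of `μ` and its prefixes.

W : ℕ → List Bool
W zero    = I ∷ []
W (suc k) = μ* (W k)

-- `μ I` begins with `I`, and `μ*` preserves prefixes.
W-suc : ∀ k → ∃[ vs ] W k ++ vs ≡ W (suc k)
W-suc zero = _ , refl
W-suc (suc k) with W-suc k
... | vs , e = μ* vs , trans (sym (concatMap-++ μ (W k) vs)) (cong μ* e)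

Cut-W : ∀ {k n ys b} → k ≤′ n → Cut (W k) ys b → Cut (W n) ys b
Cut-W ≤′-refl cut = cut
Cut-W (≤′-step {n} k≤n) cut with W-suc n
... | vs , e = subst (λ ws → Cut ws _ _) e (Cut-++ˡ vs (Cut-W k≤n cut))

Rigid-W : ∀ k → Rigid (W k)
Rigid-W zero ys cut _ _ = cong parikh (trans (empty (proj₂ (cut zero))) (sym (empty (proj₂ (cut (suc zero))))))
  where
  empty : ∀ {x ys b} → Cut (x ∷ []) ys b → ys ≡ []
  empty {ys = []}        _        = refl
  empty {ys = _ ∷ []}    (_ , ())
  empty {ys = _ ∷ _ ∷ _} (_ , ())
Rigid-W (suc k) with W-suc (suc k)
... | _ , e = Rigid-μ* (W k) e (Rigid-W k)

-- This crude doubling makes `W n` long enough to contain a letter after its first `n` letters.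
length-μ* : ∀ xs → length xs + length xs ≤ length (μ* xs)
length-μ* [] = z≤n
length-μ* (x ∷ xs) = subst₂ _≤_ (interchange 1 1 (length xs) (length xs)) (sym (length-++ (μ x)))
  (+-mono-≤ (long x) (length-μ* xs))
  where
  long : ∀ x → 2 ≤ length (μ x)
  long O = s≤s (s≤s z≤n)
  long I = s≤s (s≤s z≤n)

W-length : ∀ k → k < length (W k)
W-length zero    = s≤s z≤n
W-length (suc k) = ≤-trans (+-mono-≤ (≤-trans (s≤s z≤n) (W-length k)) (W-length k)) (length-μ* (W k))

initial : ℕ → List Bool
initial n = take n (W n)

letter : ℕ → Bool
letter n = proj₁ (Cut-take n (W n) (W-length n))

-- Since the words `W k` are nested, prefixes read off different ones become cuts of a common word.
Cut-initial : ∀ {n k} → n ≤ k → Cut (W k) (initial n) (letter n)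
Cut-initial {n} n≤k = Cut-W (≤⇒≤′ n≤k) (proj₂ (Cut-take n (W n) (W-length n)))

length-initial : ∀ n → length (initial n) ≡ n
length-initial n = trans (length-take n (W n)) (m≤n⇒m⊓n≡m (<⇒≤ (W-length n)))

initial-suc : ∀ n → initial (suc n) ≡ initial n ++ letter n ∷ []
initial-suc n = subst (λ m → take (suc m) (W (suc n)) ≡ initial n ++ letter n ∷ []) (length-initial n)
  (take-Cut (initial n) (Cut-initial (n≤1+n n)))
  where
  take-Cut : ∀ {xs b} ys → Cut xs ys b → take (suc (length ys)) xs ≡ ys ++ b ∷ []
  take-Cut []       (_ , refl)  = refl
  take-Cut (y ∷ ys) (zs , refl) = cong (y ∷_) (take-Cut ys (zs , refl))

-- Absence of `OO` and the sizes of boxes.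

-- The first argument is the letter that precedes the word.
noOO : Bool → List Bool → Bool
noOO p []       = true
noOO p (x ∷ xs) = (p ∨ x) ∧ noOO x xs

-- Both blocks begin with `I`, so no `OO` arises at a boundary; the inside of a block is checked by
-- evaluation.
noOO-μ* : ∀ p xs → T (noOO p (μ* xs))
noOO-μ* p []       = _
noOO-μ* O (O ∷ xs) = noOO-μ* O xs
noOO-μ* I (O ∷ xs) = noOO-μ* O xs
noOO-μ* O (I ∷ xs) = noOO-μ* I xs
noOO-μ* I (I ∷ xs) = noOO-μ* I xs

noOO-++⁻ : ∀ p ys {xs} → T (noOO p (ys ++ xs)) → ∃[ q ] T (noOO q xs)
noOO-++⁻ p []       t = p , t
noOO-++⁻ p (y ∷ ys) t = noOO-++⁻ y ys (proj₂ (Equivalence.to (T-∧ {p ∨ y}) t))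

letter-pair : ∀ n → T (letter n ∨ letter (suc n))
letter-pair n with Cut-initial {suc n} {suc n} ≤-refl
... | zs , e with noOO-++⁻ O (initial n) (subst (T ∘ noOO O) e′ (noOO-μ* O (W n)))
  where
  e′ : μ* (W n) ≡ initial n ++ letter n ∷ letter (suc n) ∷ zs
  e′ = trans e (trans (cong (_++ letter (suc n) ∷ zs) (initial-suc n))
    (++-assoc (initial n) (letter n ∷ []) (letter (suc n) ∷ zs)))
... | q , t = proj₁ (Equivalence.to T-∧ (proj₂ (Equivalence.to (T-∧ {q ∨ letter n}) t)))

-- The label of the box of ball `n`, both counted from 0: each earlier `I` has opened a box.
count : ℕ → ℕ
count n = ones (initial n)

count-suc : ∀ n → count (suc n) ≡ ones (letter n ∷ []) + count n
count-suc n = trans (cong ones (initial-suc n)) (trans (ones-++ (initial n) (letter n ∷ []))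
  (+-comm (count n) _))

count-I : ∀ n → letter n ≡ I → count (suc n) ≡ suc (count n)
count-I n e = trans (count-suc n) (cong (λ b → ones (b ∷ []) + count n) e)

count-≤-suc : ∀ n → count n ≤ count (suc n)
count-≤-suc n = subst (count n ≤_) (sym (count-suc n)) (m≤n+m (count n) _)

count-mono : ∀ {m n} → m ≤′ n → count m ≤ count n
count-mono ≤′-refl           = ≤-refl
count-mono (≤′-step {n} m≤n) = ≤-trans (count-mono m≤n) (count-≤-suc n)

letter-cases : ∀ n → letter n ≡ I ⊎ letter (suc n) ≡ I
letter-cases n with letter n | letter (suc n) | letter-pair n
... | I | _ | _ = inj₁ refl
... | O | I | _ = inj₂ refl

-- One of two successive letters is `I`; this is the source of the bound 2 on the fibres.
count-< : ∀ n → count n < count (2 + n)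
count-< n with letter-cases n
... | inj₁ e = ≤-trans (≤-reflexive (sym (count-I n e))) (count-≤-suc (suc n))
... | inj₂ e = ≤-trans (s≤s (count-≤-suc n)) (≤-reflexive (sym (count-I (suc n) e)))

count-surjective : ∀ m → ∃[ n ] count n ≡ m
count-surjective zero = 0 , refl
count-surjective (suc m) with count-surjective m
... | n , refl with letter n in e | letter-cases n
...   | I | _       = suc n , count-I n e
-- After `O` comes `I`, so the next box opens one ball later.
...   | O | inj₂ e′ = 2 + n , trans (count-I (suc n) e′)
  (cong suc (trans (count-suc n) (cong (λ b → ones (b ∷ []) + count n) e)))

-- `count` is monotone and rises over any two steps, so only neighbours can share a box.
count-adjacent : ∀ {m n} → count m ≡ count n → m ≢ n → suc m ≡ n ⊎ suc n ≡ m
count-adjacent {m} {n} e m≢n with <-cmp m n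
... | tri≈ _ m≡n _ = contradiction m≡n m≢n
... | tri< m<n _ _ with m≤n⇒m<n∨m≡n m<n
...   | inj₁ 2+m≤n = contradiction e (<⇒≢ (<-≤-trans (count-< m) (count-mono (≤⇒≤′ 2+m≤n))))
...   | inj₂ e′    = inj₁ e′
count-adjacent {m} {n} e m≢n | tri> _ _ n<m with m≤n⇒m<n∨m≡n n<m
...   | inj₁ 2+n≤m =
  contradiction (sym e) (<⇒≢ (<-≤-trans (count-< n) (count-mono (≤⇒≤′ 2+n≤m))))
...   | inj₂ e′    = inj₂ e′

-- Two unit steps in the same direction contradict `count-<`; in opposite directions they return to
-- `l`.
count-fibre : ∀ {l m n} → count l ≡ count m → count m ≡ count n → l ≢ m → m ≢ n → ¬ (l ≢ n)
count-fibre {l} {m} {n} e e′ l≢m m≢n l≢n with count-adjacent e l≢m | count-adjacent e′ m≢n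
... | inj₁ refl | inj₁ refl = <⇒≢ (count-< l) (trans e e′)
... | inj₁ e₁   | inj₂ e₂   = l≢n (suc-injective (trans e₁ (sym e₂)))
... | inj₂ e₁   | inj₁ e₂   = l≢n (trans (sym e₁) e₂)
... | inj₂ refl | inj₂ refl = <⇒≢ (count-< n) (sym (trans e e′))

-- The ball-box distribution.

index : ℕ⁺ → ℕ
index x = pred (value x)

suc-index : ∀ x → suc (index x) ≡ value x
suc-index (n , [ n≢0 ]) = suc-pred n {{n≢0}}

index-injective : ∀ {x y} → index x ≡ index y → x ≡ y
index-injective {x} {y} e =
  value-injective (trans (sym (suc-index x)) (trans (cong suc e) (suc-index y)))

D : ℕ⁺ → ℕ⁺
D x = suc (count (index x)) , [ _ ]

D-isDistribution : IsBallBoxDistribution 2 D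
D-isDistribution = record
  { surjective = onto
  ; fibre-size = λ _ → small
  ; monotone   = increasing
  }
  where
  onto : Surjective _≡_ _≡_ D
  onto y with count-surjective (index y)
  ... | n , e = (suc n , [ _ ]) , λ where
    refl → value-injective (trans (cong suc e) (suc-index y))

  small : ∀ {i} → AtMost 2 (Fibre D i)
  small []              _ _ = z≤n
  small (_ ∷ [])        _ _ = s≤s z≤n
  small (_ ∷ _ ∷ [])    _ _ = s≤s (s≤s z≤n)
  small (x ∷ y ∷ z ∷ _) ((x≢y ∷ x≢z ∷ _) ∷ (y≢z ∷ _) ∷ _) (ex ∷ ey ∷ ez ∷ _) =
    contradiction (x≢z ∘ index-injective)
      (count-fibre (same x y ex ey) (same y z ey ez) (x≢y ∘ index-injective) (y≢z ∘ index-injective))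
    where
    same : ∀ x y {i} → D x ≡ i → D y ≡ i → count (index x) ≡ count (index y)
    same _ _ e e′ = suc-injective (cong value (trans e (sym e′)))

  increasing : ∀ i → value (D i) ≤ value (D (suc⁺ i))
  increasing i = s≤s (subst (λ n → count (index i) ≤ count n) (suc-index i) (count-≤-suc (index i)))

-- From box progressions to progressions of prefixes.

-- The midpoint identity holds over the integers for any sign of `d`, and the cast from the naturals
-- is injective.
AP⇒Progression : ∀ {d} {h : Vector ℕ⁺ 6} → IsAPWithDifference d h → Progression (value ∘ h)
AP⇒Progression {d} {h} (a , ha) = progression λ j → ℤ.+-injective (begin
  ℤ.+ (value (h (inject₁ (inject₁ j))) + value (h (suc (suc j))))
    ≡⟨ ℤ.pos-+ (value (h (inject₁ (inject₁ j)))) _ ⟩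
  ℤ.+ value (h (inject₁ (inject₁ j))) ℤ.+ ℤ.+ value (h (suc (suc j)))
    ≡⟨ cong₂ ℤ._+_ (term (inject₁ (inject₁ j)) (trans (toℕ-inject₁ (inject₁ j)) (toℕ-inject₁ j)))
                   (ha (suc (suc j))) ⟩
  (a ℤ.+ ℤ.+ toℕ j ℤ.* d) ℤ.+ (a ℤ.+ (1ℤ ℤ.+ (1ℤ ℤ.+ ℤ.+ toℕ j)) ℤ.* d)
    ≡⟨ middle a (ℤ.+ toℕ j) d ⟩
  (a ℤ.+ (1ℤ ℤ.+ ℤ.+ toℕ j) ℤ.* d) ℤ.+ (a ℤ.+ (1ℤ ℤ.+ ℤ.+ toℕ j) ℤ.* d)
    ≡⟨ cong₂ ℤ._+_ (term (inject₁ (suc j)) (cong suc (toℕ-inject₁ j)))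
                   (term (inject₁ (suc j)) (cong suc (toℕ-inject₁ j))) ⟨
  ℤ.+ value (h (inject₁ (suc j))) ℤ.+ ℤ.+ value (h (inject₁ (suc j)))
    ≡⟨ ℤ.pos-+ (value (h (inject₁ (suc j)))) _ ⟨
  ℤ.+ (value (h (inject₁ (suc j))) + value (h (inject₁ (suc j)))) ∎)
  where
  term : ∀ i {k} → toℕ i ≡ k → ℤ.+ value (h i) ≡ a ℤ.+ ℤ.+ k ℤ.* d
  term i refl = ha i
  middle : ∀ a t d → (a ℤ.+ t ℤ.* d) ℤ.+ (a ℤ.+ (1ℤ ℤ.+ (1ℤ ℤ.+ t)) ℤ.* d) ≡
           (a ℤ.+ (1ℤ ℤ.+ t) ℤ.* d) ℤ.+ (a ℤ.+ (1ℤ ℤ.+ t) ℤ.* d)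
  middle = ℤ-Solver.solve-∀

AP-constant : ∀ {d} {h : Vector ℕ⁺ 6} → IsAPWithDifference d h →
              value (h zero) ≡ value (h (suc zero)) → d ≡ 0ℤ
AP-constant {d} {h} (a , ha) e = begin
  d                                                 ≡⟨ difference a d ⟩
  (a ℤ.+ 1ℤ ℤ.* d) ℤ.- (a ℤ.+ 0ℤ ℤ.* d)
    ≡⟨ cong₂ ℤ._-_ (ha (suc zero)) (ha zero) ⟨
  ℤ.+ value (h (suc zero)) ℤ.- ℤ.+ value (h zero)
    ≡⟨ cong (λ n → ℤ.+ value (h (suc zero)) ℤ.- ℤ.+ n) e ⟩
  ℤ.+ value (h (suc zero)) ℤ.- ℤ.+ value (h (suc zero))
    ≡⟨ ℤ.+-inverseʳ (ℤ.+ value (h (suc zero))) ⟩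
  0ℤ                                                ∎
  where
  difference : ∀ a d → d ≡ (a ℤ.+ 1ℤ ℤ.* d) ℤ.- (a ℤ.+ 0ℤ ℤ.* d)
  difference = ℤ-Solver.solve-∀

bounded : ∀ {k} (f : Fin k → ℕ) → ∃[ N ] (∀ j → f j ≤ N)
bounded {zero}  f = 0 , λ ()
bounded {suc k} f with bounded (f ∘ suc)
... | N , f≤N = f zero ⊔ N , λ where
  zero    → m≤m⊔n (f zero) N
  (suc j) → ≤-trans (f≤N j) (m≤n⊔m (f zero) N)

zeros+count : ∀ n → zeros (initial n) + count n ≡ n
zeros+count n = trans (zeros+ones (initial n)) (length-initial n)

-- Rigidity gives the first two prefixes equal letter counts, hence equal lengths; the first two
-- balls then coincide, which forces `d ≡ 0ℤ`.
no-progression : ¬ AdmitsBoxProgression 6 D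
no-progression (h , (d , d≢0 , ap) , (_ , ap′)) = d≢0 (AP-constant {h = h} ap (begin
  value (h zero)             ≡⟨ suc-index (h zero) ⟨
  suc (index (h zero))       ≡⟨ cong suc (zeros+count (index (h zero))) ⟨
  suc (zeros (initial (index (h zero))) + count (index (h zero)))
    ≡⟨ cong (λ (x , y) → suc (x + y)) same ⟩
  suc (zeros (initial (index (h (suc zero)))) + count (index (h (suc zero))))
    ≡⟨ cong suc (zeros+count (index (h (suc zero)))) ⟩
  suc (index (h (suc zero))) ≡⟨ suc-index (h (suc zero)) ⟩
  value (h (suc zero))       ∎))
  where
  indices : Progression (index ∘ h)
  -- Labels start at 1 and `index` at 0; the constant 1 is cancelled here and again in `counts`.
  indices = Progression-+⁻ˡ (Progression-cong (sym ∘ suc-index ∘ h) (AP⇒Progression {h = h} ap))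
                            (constant-progression 1)

  counts : Progression (count ∘ index ∘ h)
  counts = Progression-+⁻ˡ (AP⇒Progression {h = D ∘ h} ap′) (constant-progression 1)

  zeros-prog : Progression (zeros ∘ initial ∘ index ∘ h)
  zeros-prog = Progression-+⁻ˡ (Progression-cong (λ j → trans (sym (zeros+count (index (h j))))
    (+-comm (zeros (initial (index (h j)))) _)) indices) counts

  same : parikh (initial (index (h zero))) ≡ parikh (initial (index (h (suc zero))))
  same with bounded (index ∘ h)
  -- The bound `N` places all six prefixes in the single word `W N`.
  ... | N , ≤N = Rigid-W N (initial ∘ index ∘ h) (λ j → _ , Cut-initial (≤N j)) zeros-prog counts

corollary5p2 : ∃ λ (D : ℕ⁺ → ℕ⁺) → IsBallBoxDistribution 2 D × ¬ AdmitsBoxProgression 6 D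
corollary5p2 = D , D-isDistribution , no-progression
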